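{- Let $(\mathsf P,\mathcal O)$ be a semitopology and $p\in\mathsf P$. Then $p$ is regular if and only if $p$ is weakly regular and unconflicted.
   Context: A semitopology is a pair $(\mathsf P,\mathcal O)$ where $\mathsf P$ is a set and $\mathcal O\subseteq\mathcal P(\mathsf P)$ contains $\varnothing$ and $\mathsf P$ and is closed under arbitrary unions. Write $X\between Y$ when $X\cap Y\neq\varnothing$. $T$ is topen when it is nonempty, open, and for all open $O,O'$, $O\between T\between O'$ implies $O\between O'$. Points $p,p'$ are intertwined (written $p\between p'$) when every open set containing $p$ intersects every open set containing $p'$; $I(p)$ is the set of points intertwined with $p$; $K(p)=\mathrm{int}(I(p))$ where $\mathrm{int}(R)$ is the union of all open subsets of $R$. $p$ is regular when $p\in K(p)$ and $K(p)$ is topen; weakly regular when $p\in K(p)$. $p$ is unconflicted when for all $p',p''$, $p'\between p$ and $p\between p''$ imply $p'\between p''$ (otherwise $p$ is conflicted). -}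

module Defs where

open import Level using (Level; _⊔_; suc; Setω)
open import Data.Product using (Σ-syntax; _×_; _,_; proj₁)
open import Relation.Unary using (Pred; _∈_; _⊆_; _≐_; _≬_; ∅; U; ⋃; Satisfiable)

private
  variable
    a o r : Level

-- Subsets of Point are predicates.  Agda is predicative, so a union indexed by
-- (a subfamily of) the opens of level ℓ is a predicate of a level above ℓ; to
-- have genuinely arbitrary unions, membership in the family of open sets is a
-- property of predicates of every level, and the family is closed under unions
-- indexed by types of every level.  Open-resp-≐ says that membership depends
-- only on the extension of a predicate, including across levels.
record Semitopology (a o : Level) : Setω where
  field
    Point       : Set a
    Open        : ∀ {ℓ} → Pred Point ℓ → Set (o ⊔ ℓ)
    Open-resp-≐ : ∀ {ℓ ℓ′} {X : Pred Point ℓ} {Y : Pred Point ℓ′} →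
                  X ≐ Y → Open X → Open Y
    ∅-open      : Open ∅
    U-open      : Open U
    ⋃-open      : ∀ {i ℓ} (I : Set i) (X : I → Pred Point ℓ) →
                  (∀ j → Open (X j)) → Open (⋃ I X)

-- ℓ is the level of the open sets that "for all open sets" and "the union of all
-- open subsets" range over; it is arbitrary.  X ∩ Y ≠ ∅ and X ≠ ∅ are
-- read positively (inhabited), as _≬_ and Satisfiable.
module _ (S : Semitopology a o) (ℓ : Level) where
  open Semitopology S

  Topen : Pred Point r → Set (a ⊔ o ⊔ suc ℓ ⊔ r)
  Topen T =
    Satisfiable T ×
    Open T ×
    (∀ (O O′ : Pred Point ℓ) → Open O → Open O′ → O ≬ T → T ≬ O′ → O ≬ O′)

  Intertwined : Point → Point → Set (a ⊔ o ⊔ suc ℓ)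
  Intertwined p p′ =
    ∀ (O O′ : Pred Point ℓ) → Open O → Open O′ → p ∈ O → p′ ∈ O′ → O ≬ O′

  I : Point → Pred Point (a ⊔ o ⊔ suc ℓ)
  I p p′ = Intertwined p p′

  int : Pred Point r → Pred Point (a ⊔ o ⊔ suc ℓ ⊔ r)
  int R = ⋃ (Σ[ O ∈ Pred Point ℓ ] (Open O × O ⊆ R)) proj₁

  K : Point → Pred Point (a ⊔ o ⊔ suc ℓ)
  K p = int (I p)

  Regular : Point → Set (a ⊔ o ⊔ suc ℓ)
  Regular p = p ∈ K p × Topen (K p)

  WeaklyRegular : Point → Set (a ⊔ o ⊔ suc ℓ)
  WeaklyRegular p = p ∈ K p

  Unconflicted : Point → Set (a ⊔ o ⊔ suc ℓ)
  Unconflicted p =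
    ∀ p′ p″ → Intertwined p′ p → Intertwined p p″ → Intertwined p′ p″

{-# OPTIONS --safe #-}
module Submission where

open import Level using (Level)
open import Data.Product using (_×_; _,_; proj₁; proj₂)
open import Function.Base using (_∘_)
open import Function.Bundles using (_⇔_; mk⇔)
open import Relation.Unary using (Pred; _∈_; _⊆_; _≬_)
open import Defs

-- If p ∈ K(p), any open neighbourhood of a point intertwined with p meets K(p),
-- so topenness of K(p) makes any two such neighbourhoods meet.  Conversely,
-- points of K(p) are intertwined with p, and when p is unconflicted they are
-- intertwined with one another, which is the transitivity property of a topen.

module _ {a o : Level} (S : Semitopology a o) (ℓ : Level) where
  open Semitopology S

  Intertwined-sym : ∀ {p q} → Intertwined S ℓ p q → Intertwined S ℓ q p
  Intertwined-sym p≬q O O′ O-open O′-open q∈O p∈O′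
    with x , x∈O′ , x∈O ← p≬q O′ O O′-open O-open p∈O′ q∈O
    = x , x∈O , x∈O′

  int⊆ : ∀ {r} {R : Pred Point r} → int S ℓ R ⊆ R
  int⊆ ((_ , _ , O⊆R) , x∈O) = O⊆R x∈O

  int-open : ∀ {r} (R : Pred Point r) → Open (int S ℓ R)
  int-open R = ⋃-open _ proj₁ (proj₁ ∘ proj₂)

  -- `int S ℓ R` lives above level `ℓ`, so intertwinedness cannot be applied to it directly; it is
  -- applied to the level-`ℓ` open subset of `R` that witnesses `p ∈ int S ℓ R`.
  intertwined-meets-int : ∀ {r} {R : Pred Point r} {p q} → p ∈ int S ℓ R → Intertwined S ℓ q p →
    (O : Pred Point ℓ) → Open O → q ∈ O → O ≬ int S ℓ R
  intertwined-meets-int ((X , X-open , X⊆R) , p∈X) q≬p O O-open q∈O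
    with x , x∈O , x∈X ← q≬p O X O-open X-open q∈O p∈X
    = x , x∈O , (X , X-open , X⊆R) , x∈X

  regular⇒unconflicted : ∀ {p} → Regular S ℓ p → Unconflicted S ℓ p
  regular⇒unconflicted (p∈K , _ , _ , K-trans) p′ p″ p′≬p p≬p″ O O′ O-open O′-open p′∈O p″∈O′
    with y , y∈O′ , y∈K ← intertwined-meets-int p∈K (Intertwined-sym p≬p″) O′ O′-open p″∈O′
    = K-trans O O′ O-open O′-open
        (intertwined-meets-int p∈K p′≬p O O-open p′∈O)
        (y , y∈K , y∈O′)

  weaklyRegular∧unconflicted⇒regular : ∀ {p} → WeaklyRegular S ℓ p → Unconflicted S ℓ p → Regular S ℓ p
  weaklyRegular∧unconflicted⇒regular {p} p∈K unconflicted =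
    p∈K , (p , p∈K) , int-open (I S ℓ p) ,
    λ { O O′ O-open O′-open (q , q∈O , q∈K) (q′ , q′∈K , q′∈O′) →
        -- `O` and `O′` meet `K S ℓ p` at `q` and `q′`, both intertwined with `p`, so they are open
        -- neighbourhoods of an intertwined pair.
        unconflicted q q′ (Intertwined-sym (int⊆ q∈K)) (int⊆ q′∈K) O O′ O-open O′-open q∈O q′∈O′ }

theorem5p28 : ∀ {a o : Level} (S : Semitopology a o) (ℓ : Level) (p : Semitopology.Point S) →
    Regular S ℓ p ⇔ (WeaklyRegular S ℓ p × Unconflicted S ℓ p)
theorem5p28 S ℓ p = mk⇔
  (λ regular → proj₁ regular , regular⇒unconflicted S ℓ regular)
  (λ (p∈K , unconflicted) → weaklyRegular∧unconflicted⇒regular S ℓ p∈K unconflicted)
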